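{- For all $n\ge0$, $$F_n(x,y,q)=\sum_{k\ge0}x^{n-2k}y^kq^{\binom k2+\binom{n-k}2}\begin{bmatrix}n-k\\k\end{bmatrix}_q.$$ More precisely, for each $k$, the sum of $q^{rb(\pi)}$ over those $\pi\in\Pi_n(13/2,123)$ with exactly $k$ two-element blocks equals $q^{\binom k2+\binom{n-k}2}\begin{bmatrix}n-k\\k\end{bmatrix}_q$.
   Context: $\Pi_n(13/2,123)$ is the set of layered matchings of $[n]$: set partitions whose blocks are consecutive intervals $[1,i_1]/\dots/[i_{k-1}+1,n]$, each of size $1$ or $2$. $\Pi_0(13/2,123)$ consists of the empty partition. For $\pi=B_1/\dots/B_k$ with $\min B_1<\dots<\min B_k$, $rb(\pi)$ is the number of pairs $(b,B_j)$ with $b\in B_i$, $j>i$, $\max B_j>b$. Let $s(\pi)$ and $d(\pi)$ be the numbers of blocks of size $1$ and $2$. Define $F_n(x,y,q)=\sum_{\pi\in\Pi_n(13/2,123)}x^{s(\pi)}y^{d(\pi)}q^{rb(\pi)}$. The $q$-binomial coefficient is $\begin{bmatrix}n\\k\end{bmatrix}_q=\prod_{i=1}^k\frac{q^{n-i+1}-1}{q^i-1}$ for $0\le k\le n$, and it is $0$ if $k>n$. -}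

module Defs where

open import Algebra.Bundles using (CommutativeRing)
import Algebra.Properties.Ring as RingProperties
import Algebra.Properties.Group as GroupProperties
import Algebra.Solver.Ring.NaturalCoefficients.Default as SemiringSolver
open import Data.Bool.Base using (true; false; if_then_else_)
open import Data.Empty using (⊥-elim)
open import Data.Integer.Base as ℤ using (ℤ; 0ℤ; 1ℤ)
import Data.Integer.Properties as ℤ
open import Data.List.Base
  using (List; []; _∷_; _++_; map; foldr; concat; concatMap; length; filter; upTo; applyUpTo)
import Data.List.Properties as List
open import Data.List.Properties
  using (∷-injectiveʳ; concatMap-++; map-cong; map-id; map-∘; map-++; ++-identityʳ)
open import Data.List.Extrema.Nat using (max)
open import Data.List.Membership.Propositional using (_∈_)
open import Data.List.Membership.Propositional.Properties using (∈-map⁺; ∈-map⁻; ∈-++⁺ˡ; ∈-++⁺ʳ; ∈-++⁻)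
open import Data.List.Relation.Unary.All using (All; []; _∷_)
open import Data.List.Relation.Unary.AllPairs using ([]; _∷_)
open import Data.List.Relation.Unary.Any using (here; there)
open import Data.List.Relation.Unary.Unique.Propositional using (Unique)
import Data.List.Relation.Unary.Unique.Propositional.Properties as Unique
open import Data.Nat.Base as ℕ using (ℕ; zero; suc; _∸_)
open import Data.Nat.ListAction using (sum)
import Data.Nat.Properties as ℕ
open import Data.Product.Base using (_×_; _,_; ∃; proj₁; proj₂)
open import Data.Product.Properties using (≡-dec)
open import Data.Sum.Base using (_⊎_; inj₁; inj₂)
open import Function.Base using (_∘_)
open import Function.Bundles using (_⇔_; mk⇔)
open import Level using (Level; _⊔_)
open import Relation.Binary.Definitions using (DecidableEquality)
open import Relation.Binary.PropositionalEquality
  using (_≡_; refl; sym; trans; cong; cong₂; module ≡-Reasoning)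
import Relation.Binary.Reasoning.Setoid as SetoidReasoning
open import Relation.Nullary using (¬_; Dec; yes; no; does)

module RingOps {c ℓ : Level} (R : CommutativeRing c ℓ) where
  open CommutativeRing R
  open import Algebra.Properties.Semiring.Exp semiring public using (_^_)

  ∑ : {A : Set} → List A → (A → Carrier) → Carrier
  ∑ as f = foldr _+_ 0# (map f as)

  ∏ : {A : Set} → List A → (A → Carrier) → Carrier
  ∏ as f = foldr _*_ 1# (map f as)

  infix 3 ∑ ∏
  syntax ∑ as (λ a → e) = ∑[ a ∈ as ] e
  syntax ∏ as (λ a → e) = ∏[ a ∈ as ] e

-- The total ring of fractions of a commutative ring: denominators are the
-- regular elements (non-zero-divisors).  Over an integral domain these are
-- the non-zero elements, and the result is the field of fractions.

module Fractions {c ℓ : Level} (R : CommutativeRing c ℓ) where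
  open CommutativeRing R
    renaming (refl to ≈-refl; sym to ≈-sym; trans to ≈-trans)
  open RingProperties ring using (-‿distribˡ-*)
  open GroupProperties +-group using (x∙y⁻¹≈ε⇒x≈y)
  private module S = SemiringSolver commutativeSemiring

  Regular : Carrier → Set (c ⊔ ℓ)
  Regular d = ∀ a → d * a ≈ 0# → a ≈ 0#

  1-regular : Regular 1#
  1-regular a 1a≈0 = ≈-trans (≈-sym (*-identityˡ a)) 1a≈0

  *-regular : ∀ {d e} → Regular d → Regular e → Regular (d * e)
  *-regular {d} {e} rd re a dea≈0 =
    re a (rd (e * a) (≈-trans (≈-sym (*-assoc d e a)) dea≈0))

  *-cancelˡ : ∀ {d} → Regular d → ∀ a b → d * a ≈ d * b → a ≈ b
  *-cancelˡ {d} rd a b da≈db = x∙y⁻¹≈ε⇒x≈y a b (rd (a - b) (begin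
    d * (a - b)        ≈⟨ distribˡ d a (- b) ⟩
    d * a + d * (- b)  ≈⟨ +-cong da≈db ≈-refl ⟩
    d * b + d * (- b)  ≈⟨ distribˡ d b (- b) ⟨
    d * (b - b)        ≈⟨ *-cong ≈-refl (-‿inverseʳ b) ⟩
    d * 0#             ≈⟨ zeroʳ d ⟩
    0#                 ∎))
    where open SetoidReasoning setoid

  infix 7 _/_by_
  record Fraction : Set (c ⊔ ℓ) where
    constructor _/_by_
    field
      num     : Carrier
      den     : Carrier
      regular : Regular den
  open Fraction

  infix 4 _≃_
  record _≃_ (f g : Fraction) : Set ℓ where
    constructor cross
    field cross⁻¹ : num f * den g ≈ num g * den f

  ι : Carrier → Fraction
  ι a = a / 1# by 1-regular

  infixl 6 _⊞_
  infixl 7 _⊠_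

  _⊞_ : Fraction → Fraction → Fraction
  (a / b by r) ⊞ (a′ / b′ by r′) = (a * b′ + a′ * b) / b * b′ by *-regular r r′

  _⊠_ : Fraction → Fraction → Fraction
  (a / b by r) ⊠ (a′ / b′ by r′) = (a * a′) / b * b′ by *-regular r r′

  ⊟_ : Fraction → Fraction
  ⊟ (a / b by r) = (- a) / b by r

  private
    open SetoidReasoning setoid

    ≃-trans : ∀ {f g h} → f ≃ g → g ≃ h → f ≃ h
    ≃-trans {a / b by _} {c / d by rd} {e / f by _} (cross p) (cross q) =
      cross (*-cancelˡ rd (a * f) (e * b) (begin
        d * (a * f)  ≈⟨ S.solve 3 (λ a d f → d S.:* (a S.:* f) S.:= a S.:* d S.:* f) ≈-refl a d f ⟩
        a * d * f    ≈⟨ *-cong p ≈-refl ⟩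
        c * b * f    ≈⟨ S.solve 3 (λ c b f → c S.:* b S.:* f S.:= c S.:* f S.:* b) ≈-refl c b f ⟩
        c * f * b    ≈⟨ *-cong q ≈-refl ⟩
        e * d * b    ≈⟨ S.solve 3 (λ e d b → e S.:* d S.:* b S.:= d S.:* (e S.:* b)) ≈-refl e d b ⟩
        d * (e * b)  ∎))

    ⊞-cong : ∀ {f f′ g g′} → f ≃ f′ → g ≃ g′ → f ⊞ g ≃ f′ ⊞ g′
    ⊞-cong {a / b by _} {a′ / b′ by _} {c / d by _} {c′ / d′ by _} (cross p) (cross q) = cross (begin
      (a * d + c * b) * (b′ * d′)
        ≈⟨ S.solve 6 (λ a b c d b′ d′ → (a S.:* d S.:+ c S.:* b) S.:* (b′ S.:* d′)
                                  S.:= (a S.:* b′) S.:* (d S.:* d′) S.:+ (c S.:* d′) S.:* (b S.:* b′))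
                     ≈-refl a b c d b′ d′ ⟩
      (a * b′) * (d * d′) + (c * d′) * (b * b′)
        ≈⟨ +-cong (*-cong p ≈-refl) (*-cong q ≈-refl) ⟩
      (a′ * b) * (d * d′) + (c′ * d) * (b * b′)
        ≈⟨ S.solve 6 (λ a′ b c′ d b′ d′ → (a′ S.:* b) S.:* (d S.:* d′) S.:+ (c′ S.:* d) S.:* (b S.:* b′)
                                  S.:= (a′ S.:* d′ S.:+ c′ S.:* b′) S.:* (b S.:* d))
                     ≈-refl a′ b c′ d b′ d′ ⟩
      (a′ * d′ + c′ * b′) * (b * d) ∎)

    ⊠-cong : ∀ {f f′ g g′} → f ≃ f′ → g ≃ g′ → f ⊠ g ≃ f′ ⊠ g′
    ⊠-cong {a / b by _} {a′ / b′ by _} {c / d by _} {c′ / d′ by _} (cross p) (cross q) = cross (begin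
      (a * c) * (b′ * d′)  ≈⟨ interchange a c b′ d′ ⟩
      (a * b′) * (c * d′)  ≈⟨ *-cong p q ⟩
      (a′ * b) * (c′ * d)  ≈⟨ interchange a′ b c′ d ⟩
      (a′ * c′) * (b * d)  ∎)
      where
      interchange : ∀ w x y z → (w * x) * (y * z) ≈ (w * y) * (x * z)
      interchange = S.solve 4 (λ w x y z → (w S.:* x) S.:* (y S.:* z) S.:= (w S.:* y) S.:* (x S.:* z)) ≈-refl

    ⊟-cong : ∀ {f g} → f ≃ g → ⊟ f ≃ ⊟ g
    ⊟-cong {a / b by _} {a′ / b′ by _} (cross p) = cross (begin
      (- a) * b′    ≈⟨ -‿distribˡ-* a b′ ⟨
      - (a * b′)    ≈⟨ -‿cong p ⟩
      - (a′ * b)    ≈⟨ -‿distribˡ-* a′ b ⟩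
      (- a′) * b    ∎)

    ⊞-comm : ∀ f g → f ⊞ g ≃ g ⊞ f
    ⊞-comm (a / b by _) (c / d by _) = cross (
      S.solve 4 (λ a b c d → (a S.:* d S.:+ c S.:* b) S.:* (d S.:* b)
                       S.:= (c S.:* b S.:+ a S.:* d) S.:* (b S.:* d)) ≈-refl a b c d)

    ⊠-comm : ∀ f g → f ⊠ g ≃ g ⊠ f
    ⊠-comm (a / b by _) (c / d by _) = cross (
      S.solve 4 (λ a b c d → (a S.:* c) S.:* (d S.:* b) S.:= (c S.:* a) S.:* (b S.:* d)) ≈-refl a b c d)

    ⊞-assoc : ∀ f g h → (f ⊞ g) ⊞ h ≃ f ⊞ (g ⊞ h)
    ⊞-assoc (a / b by _) (c / d by _) (e / f by _) = cross (
      S.solve 6 (λ a b c d e f →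
        ((a S.:* d S.:+ c S.:* b) S.:* f S.:+ e S.:* (b S.:* d)) S.:* (b S.:* (d S.:* f))
        S.:= (a S.:* (d S.:* f) S.:+ (c S.:* f S.:+ e S.:* d) S.:* b) S.:* (b S.:* d S.:* f))
        ≈-refl a b c d e f)

    ⊠-assoc : ∀ f g h → (f ⊠ g) ⊠ h ≃ f ⊠ (g ⊠ h)
    ⊠-assoc (a / b by _) (c / d by _) (e / f by _) = cross (
      S.solve 6 (λ a b c d e f →
        ((a S.:* c) S.:* e) S.:* (b S.:* (d S.:* f)) S.:= (a S.:* (c S.:* e)) S.:* (b S.:* d S.:* f))
        ≈-refl a b c d e f)

    ⊞-identityˡ : ∀ f → ι 0# ⊞ f ≃ f
    ⊞-identityˡ (a / b by _) = cross (
      S.solve 2 (λ a b → (S.con 0 S.:* b S.:+ a S.:* S.con 1) S.:* b S.:= a S.:* (S.con 1 S.:* b))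
        ≈-refl a b)

    ⊠-identityˡ : ∀ f → ι 1# ⊠ f ≃ f
    ⊠-identityˡ (a / b by _) = cross (
      S.solve 2 (λ a b → (S.con 1 S.:* a) S.:* b S.:= a S.:* (S.con 1 S.:* b)) ≈-refl a b)

    ⊞-inverseˡ : ∀ f → (⊟ f) ⊞ f ≃ ι 0#
    ⊞-inverseˡ (a / b by _) = cross (begin
      ((- a) * b + a * b) * 1#  ≈⟨ *-identityʳ _ ⟩
      (- a) * b + a * b         ≈⟨ distribʳ b (- a) a ⟨
      (- a + a) * b             ≈⟨ *-cong (-‿inverseˡ a) ≈-refl ⟩
      0# * b                    ≈⟨ zeroˡ b ⟩
      0#                        ≈⟨ zeroˡ (b * b) ⟨
      0# * (b * b)              ∎)

    ⊠-distribˡ-⊞ : ∀ f g h → f ⊠ (g ⊞ h) ≃ (f ⊠ g) ⊞ (f ⊠ h)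
    ⊠-distribˡ-⊞ (a / b by _) (c / d by _) (e / f by _) = cross (
      S.solve 6 (λ a b c d e f →
        (a S.:* (c S.:* f S.:+ e S.:* d)) S.:* ((b S.:* d) S.:* (b S.:* f))
        S.:= (a S.:* c S.:* (b S.:* f) S.:+ a S.:* e S.:* (b S.:* d)) S.:* (b S.:* (d S.:* f)))
        ≈-refl a b c d e f)

    ⊠-distribʳ-⊞ : ∀ f g h → (g ⊞ h) ⊠ f ≃ (g ⊠ f) ⊞ (h ⊠ f)
    ⊠-distribʳ-⊞ (a / b by _) (c / d by _) (e / f by _) = cross (
      S.solve 6 (λ a b c d e f →
        ((c S.:* f S.:+ e S.:* d) S.:* a) S.:* ((d S.:* b) S.:* (f S.:* b))
        S.:= (c S.:* a S.:* (f S.:* b) S.:+ e S.:* a S.:* (d S.:* b)) S.:* (d S.:* f S.:* b))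
        ≈-refl a b c d e f)

  fractionRing : CommutativeRing (c ⊔ ℓ) ℓ
  fractionRing = record
    { Carrier = Fraction ; _≈_ = _≃_ ; _+_ = _⊞_ ; _*_ = _⊠_ ; -_ = ⊟_ ; 0# = ι 0# ; 1# = ι 1#
    ; isCommutativeRing = record
      { isRing = record
        { +-isAbelianGroup = record
          { isGroup = record
            { isMonoid = record
              { isSemigroup = record
                { isMagma = record
                  { isEquivalence = record
                    { refl = cross ≈-refl ; sym = λ (cross p) → cross (≈-sym p) ; trans = ≃-trans }
                  ; ∙-cong = ⊞-cong }
                ; assoc = ⊞-assoc }
              ; identity = ⊞-identityˡ
                , λ f → ≃-trans (⊞-comm f (ι 0#)) (⊞-identityˡ f) }
            ; inverse = ⊞-inverseˡ
              , λ f → ≃-trans (⊞-comm f (⊟ f)) (⊞-inverseˡ f)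
            ; ⁻¹-cong = ⊟-cong }
          ; comm = ⊞-comm }
        ; *-cong = ⊠-cong
        ; *-assoc = ⊠-assoc
        ; *-identity = ⊠-identityˡ
          , λ f → ≃-trans (⊠-comm f (ι 1#)) (⊠-identityˡ f)
        ; distrib = ⊠-distribˡ-⊞ , ⊠-distribʳ-⊞ }
      ; *-comm = ⊠-comm } }

-- The polynomial ring ℤ[x,y,q].  (i , j , k) stands for xⁱ yʲ qᵏ, and a
-- polynomial is a formal sum of terms; repeated and zero terms are allowed,
-- polynomials being equal when all their coefficients agree.

Monomial : Set
Monomial = ℕ × ℕ × ℕ

infixl 6 _⊕_
_⊕_ : Monomial → Monomial → Monomial
(i , j , k) ⊕ (i′ , j′ , k′) = i ℕ.+ i′ , j ℕ.+ j′ , k ℕ.+ k′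

_≟ᵐ_ : DecidableEquality Monomial
_≟ᵐ_ = ≡-dec ℕ._≟_ (≡-dec ℕ._≟_ ℕ._≟_)

Term : Set
Term = ℤ × Monomial

Polynomial : Set
Polynomial = List Term

coeffᵗ : Term → Monomial → ℤ
coeffᵗ (c , e) m = if does (e ≟ᵐ m) then c else 0ℤ

coeff : Polynomial → Monomial → ℤ
coeff []      m = 0ℤ
coeff (t ∷ p) m = coeffᵗ t m ℤ.+ coeff p m

infix 4 _≈ᵖ_
record _≈ᵖ_ (p r : Polynomial) : Set where
  constructor coeffs
  field at : ∀ m → coeff p m ≡ coeff r m
open _≈ᵖ_ public

_·_ : Term → Term → Term
(c , e) · (c′ , e′) = c ℤ.* c′ , e ⊕ e′

infixl 7 _*ᵖ_
_*ᵖ_ : Polynomial → Polynomial → Polynomial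
p *ᵖ r = concatMap (λ t → map (t ·_) r) p

-ᵖ_ : Polynomial → Polynomial
-ᵖ p = map (λ (c , e) → ℤ.- c , e) p

1ᵖ : Polynomial
1ᵖ = (1ℤ , 0 , 0 , 0) ∷ []

private
  ⊕-comm : ∀ e e′ → e ⊕ e′ ≡ e′ ⊕ e
  ⊕-comm (i , j , k) (i′ , j′ , k′) =
    cong₂ _,_ (ℕ.+-comm i i′) (cong₂ _,_ (ℕ.+-comm j j′) (ℕ.+-comm k k′))

  ⊕-assoc : ∀ e e′ e″ → (e ⊕ e′) ⊕ e″ ≡ e ⊕ (e′ ⊕ e″)
  ⊕-assoc (i , j , k) (i′ , j′ , k′) (i″ , j″ , k″) =
    cong₂ _,_ (ℕ.+-assoc i i′ i″) (cong₂ _,_ (ℕ.+-assoc j j′ j″) (ℕ.+-assoc k k′ k″))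

  ⊕-cancelˡ : ∀ e {m m′} → e ⊕ m ≡ e ⊕ m′ → m ≡ m′
  ⊕-cancelˡ (i , j , k) eq =
    cong₂ _,_ (ℕ.+-cancelˡ-≡ i _ _ (cong proj₁ eq))
      (cong₂ _,_ (ℕ.+-cancelˡ-≡ j _ _ (cong (proj₁ ∘ proj₂) eq))
                 (ℕ.+-cancelˡ-≡ k _ _ (cong (proj₂ ∘ proj₂) eq)))

  _∣ᵐ_ : Monomial → Monomial → Set
  e ∣ᵐ m = ∃ λ m′ → e ⊕ m′ ≡ m

  _∣ᵐ?_ : ∀ e m → Dec (e ∣ᵐ m)
  (i , j , k) ∣ᵐ? (a , b , c) with i ℕ.≤? a | j ℕ.≤? b | k ℕ.≤? c
  ... | no i≰a | _ | _ = no λ { (_ , refl) → i≰a (ℕ.m≤m+n i _) }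
  ... | yes _ | no j≰b | _ = no λ { (_ , refl) → j≰b (ℕ.m≤m+n j _) }
  ... | yes _ | yes _ | no k≰c = no λ { (_ , refl) → k≰c (ℕ.m≤m+n k _) }
  ... | yes i≤a | yes j≤b | yes k≤c =
    yes ((a ∸ i , b ∸ j , c ∸ k)
        , cong₂ _,_ (ℕ.m+[n∸m]≡n i≤a) (cong₂ _,_ (ℕ.m+[n∸m]≡n j≤b) (ℕ.m+[n∸m]≡n k≤c)))

  ·-comm : ∀ t u → t · u ≡ u · t
  ·-comm (c , e) (c′ , e′) = cong₂ _,_ (ℤ.*-comm c c′) (⊕-comm e e′)

  ·-assoc : ∀ t u v → (t · u) · v ≡ t · (u · v)
  ·-assoc (c , e) (c′ , e′) (c″ , e″) = cong₂ _,_ (ℤ.*-assoc c c′ c″) (⊕-assoc e e′ e″)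

  coeff-++ : ∀ p r m → coeff (p ++ r) m ≡ coeff p m ℤ.+ coeff r m
  coeff-++ []      r m = sym (ℤ.+-identityˡ _)
  coeff-++ (t ∷ p) r m = trans (cong (ℤ._+_ (coeffᵗ t m)) (coeff-++ p r m))
    (sym (ℤ.+-assoc (coeffᵗ t m) (coeff p m) (coeff r m)))

  coeff-- : ∀ p m → coeff (-ᵖ p) m ≡ ℤ.- coeff p m
  coeff-- []            m = refl
  coeff-- ((c , e) ∷ p) m with does (e ≟ᵐ m)
  ... | true  = trans (cong (ℤ._+_ (ℤ.- c)) (coeff-- p m)) (sym (ℤ.neg-distrib-+ c _))
  ... | false = trans (cong (ℤ._+_ 0ℤ) (coeff-- p m)) (sym (ℤ.neg-distrib-+ 0ℤ (coeff p m)))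

  coeff-·-∣ : ∀ c e p m → coeff (map ((c , e) ·_) p) (e ⊕ m) ≡ c ℤ.* coeff p m
  coeff-·-∣ c e []              m = sym (ℤ.*-zeroʳ c)
  coeff-·-∣ c e ((c′ , e′) ∷ p) m with (e ⊕ e′) ≟ᵐ (e ⊕ m) | e′ ≟ᵐ m
  ... | yes _   | yes _   =
    trans (cong (ℤ._+_ (c ℤ.* c′)) (coeff-·-∣ c e p m)) (sym (ℤ.*-distribˡ-+ c c′ (coeff p m)))
  ... | yes eq  | no neq  = ⊥-elim (neq (⊕-cancelˡ e eq))
  ... | no neq  | yes eq  = ⊥-elim (neq (cong (e ⊕_) eq))
  ... | no _    | no _    =
    trans (ℤ.+-identityˡ _) (trans (coeff-·-∣ c e p m) (cong (c ℤ.*_) (sym (ℤ.+-identityˡ _))))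

  coeff-·-∤ : ∀ c e p m → ¬ (e ∣ᵐ m) → coeff (map ((c , e) ·_) p) m ≡ 0ℤ
  coeff-·-∤ c e []              m e∤m = refl
  coeff-·-∤ c e ((c′ , e′) ∷ p) m e∤m with (e ⊕ e′) ≟ᵐ m
  ... | yes eq = ⊥-elim (e∤m (e′ , eq))
  ... | no _   = trans (ℤ.+-identityˡ _) (coeff-·-∤ c e p m e∤m)

  ≈ᵖ-refl : ∀ {p} → p ≈ᵖ p
  ≈ᵖ-refl = coeffs λ m → refl

  reflexive : ∀ {p r} → p ≡ r → p ≈ᵖ r
  reflexive refl = ≈ᵖ-refl

  ≈ᵖ-sym : ∀ {p r} → p ≈ᵖ r → r ≈ᵖ p
  ≈ᵖ-sym f = coeffs λ m → sym (at f m)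

  infixr 2 _⟫_
  _⟫_ : ∀ {p r s} → p ≈ᵖ r → r ≈ᵖ s → p ≈ᵖ s
  f ⟫ g = coeffs λ m → trans (at f m) (at g m)

  ·-congʳ : ∀ t {p r} → p ≈ᵖ r → map (t ·_) p ≈ᵖ map (t ·_) r
  ·-congʳ (c , e) {p} {r} p≈r = coeffs go
    where
    go : ∀ m → coeff (map ((c , e) ·_) p) m ≡ coeff (map ((c , e) ·_) r) m
    go m with e ∣ᵐ? m
    ... | yes (m′ , refl) =
      trans (coeff-·-∣ c e p m′) (trans (cong (c ℤ.*_) (at p≈r m′)) (sym (coeff-·-∣ c e r m′)))
    ... | no e∤m = trans (coeff-·-∤ c e p m e∤m) (sym (coeff-·-∤ c e r m e∤m))

  -ᵖ-cong : ∀ {p r} → p ≈ᵖ r → -ᵖ p ≈ᵖ -ᵖ r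
  -ᵖ-cong {p} {r} p≈r =
    coeffs λ m → trans (coeff-- p m) (trans (cong ℤ.-_ (at p≈r m)) (sym (coeff-- r m)))

  ++-cong : ∀ {p p′ r r′} → p ≈ᵖ p′ → r ≈ᵖ r′ → p ++ r ≈ᵖ p′ ++ r′
  ++-cong {p} {p′} {r} {r′} p≈ r≈ = coeffs λ m →
    trans (coeff-++ p r m) (trans (cong₂ ℤ._+_ (at p≈ m) (at r≈ m)) (sym (coeff-++ p′ r′ m)))

  ++-comm : ∀ p r → p ++ r ≈ᵖ r ++ p
  ++-comm p r = coeffs λ m →
    trans (coeff-++ p r m) (trans (ℤ.+-comm (coeff p m) _) (sym (coeff-++ r p m)))

  ++-assoc : ∀ p r s → (p ++ r) ++ s ≈ᵖ p ++ (r ++ s)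
  ++-assoc p r s = reflexive (List.++-assoc p r s)

  ++-inverseˡ : ∀ p → (-ᵖ p) ++ p ≈ᵖ []
  ++-inverseˡ p = coeffs λ m → trans (coeff-++ (-ᵖ p) p m)
    (trans (cong (ℤ._+ coeff p m) (coeff-- p m)) (ℤ.+-inverseˡ (coeff p m)))

  *-congʳ : ∀ p {r r′} → r ≈ᵖ r′ → p *ᵖ r ≈ᵖ p *ᵖ r′
  *-congʳ []      r≈ = ≈ᵖ-refl
  *-congʳ (t ∷ p) r≈ = ++-cong (·-congʳ t r≈) (*-congʳ p r≈)

  *-nil : ∀ p → p *ᵖ [] ≡ []
  *-nil []      = refl
  *-nil (t ∷ p) = *-nil p

  *-cons : ∀ p u r → p *ᵖ (u ∷ r) ≈ᵖ map (u ·_) p ++ p *ᵖ r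
  *-cons []      u r = ≈ᵖ-refl
  *-cons (t ∷ p) u r = ++-cong {t · u ∷ []} (reflexive (cong (_∷ []) (·-comm t u)))
    ( ++-cong {map (t ·_) r} ≈ᵖ-refl (*-cons p u r)
    ⟫ ≈ᵖ-sym (++-assoc (map (t ·_) r) (map (u ·_) p) (p *ᵖ r))
    ⟫ ++-cong (++-comm (map (t ·_) r) (map (u ·_) p)) ≈ᵖ-refl
    ⟫ ++-assoc (map (u ·_) p) (map (t ·_) r) (p *ᵖ r) )

  *-comm : ∀ p r → p *ᵖ r ≈ᵖ r *ᵖ p
  *-comm p []      = reflexive (*-nil p)
  *-comm p (u ∷ r) = *-cons p u r ⟫ ++-cong ≈ᵖ-refl (*-comm p r)

  *-cong : ∀ {p p′ r r′} → p ≈ᵖ p′ → r ≈ᵖ r′ → p *ᵖ r ≈ᵖ p′ *ᵖ r′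
  *-cong {p} {p′} {r} {r′} p≈ r≈ =
    *-congʳ p r≈ ⟫ *-comm p r′ ⟫ *-congʳ r′ p≈ ⟫ *-comm r′ p′

  *-distribʳ : ∀ s p r → (p ++ r) *ᵖ s ≡ p *ᵖ s ++ r *ᵖ s
  *-distribʳ s p r = concatMap-++ (λ t → map (t ·_) s) p r

  *-distribˡ : ∀ s p r → s *ᵖ (p ++ r) ≈ᵖ s *ᵖ p ++ s *ᵖ r
  *-distribˡ s p r =
    *-comm s (p ++ r) ⟫ reflexive (*-distribʳ s p r) ⟫ ++-cong (*-comm p s) (*-comm r s)

  ·-*-assoc : ∀ t r s → map (t ·_) r *ᵖ s ≡ map (t ·_) (r *ᵖ s)
  ·-*-assoc t []      s = refl
  ·-*-assoc t (u ∷ r) s = begin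
    map ((t · u) ·_) s ++ map (t ·_) r *ᵖ s
      ≡⟨ cong₂ _++_ (trans (map-cong (·-assoc t u) s) (map-∘ s)) (·-*-assoc t r s) ⟩
    map (t ·_) (map (u ·_) s) ++ map (t ·_) (r *ᵖ s)
      ≡⟨ map-++ (t ·_) (map (u ·_) s) (r *ᵖ s) ⟨
    map (t ·_) (map (u ·_) s ++ r *ᵖ s) ∎
    where open ≡-Reasoning

  *-assoc : ∀ p r s → (p *ᵖ r) *ᵖ s ≡ p *ᵖ (r *ᵖ s)
  *-assoc []      r s = refl
  *-assoc (t ∷ p) r s =
    trans (*-distribʳ s (map (t ·_) r) (p *ᵖ r)) (cong₂ _++_ (·-*-assoc t r s) (*-assoc p r s))

  *-identityˡ : ∀ p → 1ᵖ *ᵖ p ≡ p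
  *-identityˡ p = trans (++-identityʳ _)
    (trans (map-cong (λ (c , e) → cong (_, e) (ℤ.*-identityˡ c)) p) (map-id p))

ℤ[x,y,q] : CommutativeRing _ _
ℤ[x,y,q] = record
  { Carrier = Polynomial ; _≈_ = _≈ᵖ_ ; _+_ = _++_ ; _*_ = _*ᵖ_ ; -_ = -ᵖ_ ; 0# = [] ; 1# = 1ᵖ
  ; isCommutativeRing = record
    { isRing = record
      { +-isAbelianGroup = record
        { isGroup = record
          { isMonoid = record
            { isSemigroup = record
              { isMagma = record
                { isEquivalence = record { refl = ≈ᵖ-refl ; sym = ≈ᵖ-sym ; trans = _⟫_ }
                ; ∙-cong = ++-cong }
              ; assoc = ++-assoc }
            ; identity = (λ p → ≈ᵖ-refl) , λ p → reflexive (++-identityʳ p) }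
          ; inverse = ++-inverseˡ , λ p → ++-comm p (-ᵖ p) ⟫ ++-inverseˡ p
          ; ⁻¹-cong = -ᵖ-cong }
        ; comm = ++-comm }
      ; *-cong = *-cong
      ; *-assoc = λ p r s → reflexive (*-assoc p r s)
      ; *-identity = (λ p → reflexive (*-identityˡ p))
                   , λ p → *-comm p 1ᵖ ⟫ reflexive (*-identityˡ p)
      ; distrib = *-distribˡ , λ s p r → reflexive (*-distribʳ s p r) }
    ; *-comm = *-comm } }

module P where
  open CommutativeRing ℤ[x,y,q] public
  open RingOps ℤ[x,y,q] public

x y q : P.Carrier
x = (1ℤ , 1 , 0 , 0) ∷ []
y = (1ℤ , 0 , 1 , 0) ∷ []
q = (1ℤ , 0 , 0 , 1) ∷ []

-- ℤ[x,y,q] is an integral domain, so fractionRing is the field ℚ(x,y,q).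
open Fractions ℤ[x,y,q] public using (Regular; Fraction; _/_by_; _≃_; cross; ι; fractionRing)

module K where
  open CommutativeRing fractionRing public
  open RingOps fractionRing public

private
  q^ : ∀ i → q P.^ i ≡ (1ℤ , 0 , 0 , i) ∷ []
  q^ zero    = refl
  q^ (suc i) = cong (q P.*_) (q^ i)

  shift : ∀ i a m → coeff (q P.^ i P.* a) m ≡ coeff (map ((1ℤ , 0 , 0 , i) ·_) a) m
  shift i a m = cong (λ p → coeff p m) (trans (cong (P._* a) (q^ i)) (++-identityʳ _))

q^i-1-regular : ∀ i .{{_ : ℕ.NonZero i}} → Regular (q P.^ i P.- P.1#)
q^i-1-regular i a [qⁱ-1]a≈0 = coeffs λ (b , c , d) → go b c (suc d) d ℕ.≤-refl
  where
  e : Monomial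
  e = 0 , 0 , i

  qⁱa≈a : q P.^ i P.* a P.≈ a
  qⁱa≈a = x∙y⁻¹≈ε⇒x≈y (q P.^ i P.* a) a (begin
    q P.^ i P.* a P.+ P.- a               ≈⟨ P.+-congˡ (-1*x≈-x a) ⟨
    q P.^ i P.* a P.+ P.- P.1# P.* a      ≈⟨ P.distribʳ a (q P.^ i) (P.- P.1#) ⟨
    (q P.^ i P.- P.1#) P.* a              ≈⟨ [qⁱ-1]a≈0 ⟩
    P.0#                                  ∎)
    where
    open SetoidReasoning P.setoid
    open GroupProperties P.+-group using (x∙y⁻¹≈ε⇒x≈y)
    open RingProperties P.ring using (-1*x≈-x)

  -- Since a ≈ qⁱ a, the coefficient of qᵈ in a is that of qᵈ⁻ⁱ, or 0.
  go : ∀ b c n d → d ℕ.< n → coeff a (b , c , d) ≡ 0ℤ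
  go b c (suc n) d (ℕ.s≤s d≤n) with e ∣ᵐ? (b , c , d)
  ... | no e∤m = trans (sym (at qⁱa≈a _)) (trans (shift i a _) (coeff-·-∤ 1ℤ e a _ e∤m))
  ... | yes ((_ , _ , d′) , refl) = begin
    coeff a (b , c , i ℕ.+ d′)                            ≡⟨ at qⁱa≈a _ ⟨
    coeff (q P.^ i P.* a) (b , c , i ℕ.+ d′)              ≡⟨ shift i a _ ⟩
    coeff (map ((1ℤ , e) ·_) a) (e ⊕ (b , c , d′))        ≡⟨ coeff-·-∣ 1ℤ e a (b , c , d′) ⟩
    1ℤ ℤ.* coeff a (b , c , d′)                           ≡⟨ ℤ.*-identityˡ _ ⟩
    coeff a (b , c , d′)                                  ≡⟨ go b c n d′ (ℕ.<-≤-trans (ℕ.m<n+m d′ (ℕ.>-nonZero⁻¹ i)) d≤n) ⟩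
    0ℤ                                                    ∎
    where open ≡-Reasoning

-- The index j runs from 0 and stands for i = j + 1.
qBinomial : ℕ → ℕ → K.Carrier
qBinomial n k =
  if does (k ℕ.≤? n)
  then K.∏[ j ∈ upTo k ] (q P.^ (n ∸ suc j ℕ.+ 1) P.- P.1#) / (q P.^ suc j P.- P.1#) by q^i-1-regular (suc j)
  else K.0#

-- A set partition B₁/…/B_k of [n], as the list of its blocks ordered by
-- minimum, each block listed increasingly.
Partition : Set
Partition = List (List ℕ)

-- The blocks are [1,i₁], [i₁+1,i₂], …, [i_{k-1}+1,n] exactly when listing them
-- one after the other gives 1, 2, …, n.
IsLayeredMatching : ℕ → Partition → Set
IsLayeredMatching n π =
  concat π ≡ applyUpTo suc n × All (λ B → length B ≡ 1 ⊎ length B ≡ 2) π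

-- All ways to cut a list into consecutive pieces of size 1 or 2.
cuts : {A : Set} → List A → List (List (List A))
cuts []           = [] ∷ []
cuts (a ∷ [])     = ((a ∷ []) ∷ []) ∷ []
cuts (a ∷ b ∷ as) = map ((a ∷ []) ∷_) (cuts (b ∷ as)) ++ map ((a ∷ b ∷ []) ∷_) (cuts as)

-- Π_n(13/2,123); see ∈Π⇔ and Π-unique.
Π : ℕ → List Partition
Π n = cuts (applyUpTo suc n)

private
  IsCut : {A : Set} → List A → List (List A) → Set
  IsCut as π = concat π ≡ as × All (λ B → length B ≡ 1 ⊎ length B ≡ 2) π

  cuts-sound : {A : Set} (as : List A) → ∀ {π} → π ∈ cuts as → IsCut as π
  cuts-sound []           (here refl) = refl , []
  cuts-sound (a ∷ [])     (here refl) = refl , inj₁ refl ∷ []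
  cuts-sound (a ∷ b ∷ as) π∈ with ∈-++⁻ (map ((a ∷ []) ∷_) (cuts (b ∷ as))) π∈
  ... | inj₁ π∈₁ with ∈-map⁻ _ π∈₁
  ...   | _ , π′∈ , refl with cuts-sound (b ∷ as) π′∈
  ...     | eq , sizes = cong (a ∷_) eq , inj₁ refl ∷ sizes
  cuts-sound (a ∷ b ∷ as) π∈ | inj₂ π∈₂ with ∈-map⁻ _ π∈₂
  ...   | _ , π′∈ , refl with cuts-sound as π′∈
  ...     | eq , sizes = cong (λ l → a ∷ b ∷ l) eq , inj₂ refl ∷ sizes

  cuts-complete : {A : Set} (as : List A) → ∀ π → IsCut as π → π ∈ cuts as
  cuts-complete []           [] (eq , _) = here refl
  cuts-complete (a ∷ as)     [] (() , _)
  cuts-complete _ ([] ∷ π)              (eq , inj₁ () ∷ _)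
  cuts-complete _ ([] ∷ π)              (eq , inj₂ () ∷ _)
  cuts-complete _ ((_ ∷ _ ∷ _ ∷ _) ∷ π) (eq , inj₁ () ∷ _)
  cuts-complete _ ((_ ∷ _ ∷ _ ∷ _) ∷ π) (eq , inj₂ () ∷ _)
  cuts-complete _ ((a ∷ []) ∷ π) (refl , _ ∷ sizes) with concat π in eq
  ... | b ∷ as = ∈-++⁺ˡ (∈-map⁺ _ (cuts-complete (b ∷ as) π (eq , sizes)))
  ... | [] with cuts-complete [] π (eq , sizes)
  ...   | here refl = here refl
  cuts-complete _ ((a ∷ b ∷ []) ∷ π) (refl , _ ∷ sizes) =
    ∈-++⁺ʳ (map ((a ∷ []) ∷_) (cuts (b ∷ concat π))) (∈-map⁺ _ (cuts-complete (concat π) π (refl , sizes)))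

  cuts-unique : {A : Set} (as : List A) → Unique (cuts as)
  cuts-unique []           = [] ∷ []
  cuts-unique (a ∷ [])     = [] ∷ []
  cuts-unique (a ∷ b ∷ as) = Unique.++⁺
    (Unique.map⁺ ∷-injectiveʳ (cuts-unique (b ∷ as)))
    (Unique.map⁺ ∷-injectiveʳ (cuts-unique as))
    λ (π∈₁ , π∈₂) → disjoint (∈-map⁻ _ π∈₁) (∈-map⁻ _ π∈₂)
    where
    disjoint : ∀ {π} → (∃ λ π₁ → π₁ ∈ cuts (b ∷ as) × π ≡ (a ∷ []) ∷ π₁) →
               ¬ (∃ λ π₂ → π₂ ∈ cuts as × π ≡ (a ∷ b ∷ []) ∷ π₂)
    disjoint (_ , _ , refl) (_ , _ , ())

∈Π⇔ : ∀ n π → π ∈ Π n ⇔ IsLayeredMatching n π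
∈Π⇔ n π = mk⇔ (cuts-sound (applyUpTo suc n)) (cuts-complete (applyUpTo suc n) π)

Π-unique : ∀ n → Unique (Π n)
Π-unique n = cuts-unique (applyUpTo suc n)

-- max 0 C is the maximum of the (non-empty) block C.
rb : Partition → ℕ
rb []       = 0
rb (B ∷ Bs) = sum (map (λ b → length (filter (λ C → b ℕ.<? max 0 C) Bs)) B) ℕ.+ rb Bs

s : Partition → ℕ
s π = length (filter (λ B → length B ℕ.≟ 1) π)

d : Partition → ℕ
d π = length (filter (λ B → length B ℕ.≟ 2) π)

F : ℕ → P.Carrier
F n = P.∑[ π ∈ Π n ] x P.^ s π P.* y P.^ d π P.* q P.^ rb π

{-# OPTIONS --safe #-}

-- Every block following B in a layered matching has a maximum exceeding each element of B,
-- so rb(π) = ∑ᵢ |Bᵢ| (m - i), where m is the number of blocks. Splitting off the first block,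
-- which is followed by m blocks, the sum H(m, k) of q^rb over the matchings with m blocks, k of
-- them of size 2, satisfies
--   H(m+1, k+1) = q^m H(m, k+1) + q^(2m) H(m, k),
-- and q^(C(k,2) + C(m,2)) [m choose k]_q obeys the same recurrence because of the q-Pascal rule
--   [m+1 choose k+1]_q = [m choose k+1]_q + q^(m-k) [m choose k]_q.
-- The latter is taken as the definition of the Gaussian polynomials in ℤ[x,y,q], which are then
-- identified with the fractions qBinomial by clearing denominators.

module Submission where

open import Algebra.Bundles using (CommutativeRing)
import Algebra.Solver.Ring.NaturalCoefficients.Default as SemiringSolver
open import Data.Bool.Base using (true; false; if_then_else_)
open import Data.List.Base using (List; []; _∷_; _++_; map; foldr; length; upTo; applyUpTo; filter)
open import Data.List.Extrema.Nat using (max; v<max⁺)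
open import Data.List.Membership.Propositional using (_∈_)
open import Data.List.Membership.Propositional.Properties
  using (∈-map⁻; ∈-++⁻; ∈-filter⁻; ∈-upTo⁻)
open import Data.List.Properties
  using (filter-++; filter-all; filter-none; map-upTo; map-applyUpTo; upTo-∷ʳ; length-applyUpTo)
open import Data.List.Relation.Unary.All as All using (All; []; _∷_)
import Data.List.Relation.Unary.All.Properties as All
open import Data.List.Relation.Unary.AllPairs using (AllPairs; []; _∷_)
import Data.List.Relation.Unary.AllPairs.Properties as AllPairs
open import Data.List.Relation.Unary.Any using (here; there)
open import Data.Nat using (ℕ; zero; suc; _+_; _*_; _∸_; _≤_; _<_; _≟_; _≤?_; _<?_; z≤n; s≤s)
open import Data.Nat.Combinatorics using (_C_; nC1≡n; nCk+nC[k+1]≡[n+1]C[k+1])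
import Data.Nat.Properties as ℕ
open import Data.Nat.Solver using (module +-*-Solver)
open import Data.Product using (_×_; _,_)
open import Data.Sum.Base using (inj₁; inj₂)
open import Function.Base using (_∘_)
open import Level using (Level)
import Relation.Binary.PropositionalEquality as ≡
open ≡ using (_≡_; _≢_; cong; cong₂)
import Relation.Binary.Reasoning.Setoid as SetoidReasoning
open import Relation.Nullary using (yes; no; does)
open import Relation.Nullary.Decidable using (dec-true; dec-false)
open import Relation.Unary using (Pred; Decidable)
open import Defs

-- Cuts of a list into pieces of size 1 or 2

-- Inductive form of membership in `cuts`. The special clause of `cuts` for one-element lists is
-- absorbed by `single`, so inductions have one case per block size.
data Cut {A : Set} : List A → List (List A) → Set where
  []     : Cut [] []
  single : ∀ a {as π} → Cut as π → Cut (a ∷ as) ((a ∷ []) ∷ π)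
  double : ∀ a b {as π} → Cut as π → Cut (a ∷ b ∷ as) ((a ∷ b ∷ []) ∷ π)

∈-cuts⁻ : ∀ {A : Set} (as : List A) {π} → π ∈ cuts as → Cut as π
∈-cuts⁻ []           (here ≡.refl) = []
∈-cuts⁻ (a ∷ [])     (here ≡.refl) = single a []
∈-cuts⁻ (a ∷ b ∷ as) π∈ with ∈-++⁻ (map ((a ∷ []) ∷_) (cuts (b ∷ as))) π∈
... | inj₁ π∈₁ with _ , π′∈ , ≡.refl ← ∈-map⁻ _ π∈₁ = single a (∈-cuts⁻ (b ∷ as) π′∈)
... | inj₂ π∈₂ with _ , π′∈ , ≡.refl ← ∈-map⁻ _ π∈₂ = double a b (∈-cuts⁻ as π′∈)

length+d≡length : ∀ {as π} → Cut as π → length π + d π ≡ length as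
length+d≡length []                     = ≡.refl
length+d≡length (single a cut)         = cong suc (length+d≡length cut)
length+d≡length (double a b {π = π} cut) =
  cong suc (≡.trans (ℕ.+-suc (length π) (d π)) (cong suc (length+d≡length cut)))

2d+s≡length : ∀ {as π} → Cut as π → 2 * d π + s π ≡ length as
2d+s≡length []                     = ≡.refl
2d+s≡length (single a {π = π} cut) =
  ≡.trans (ℕ.+-suc (2 * d π) (s π)) (cong suc (2d+s≡length cut))
2d+s≡length (double a b {π = π} cut) = ≡.trans
  (solve 2 (λ d s → con 2 :* (con 1 :+ d) :+ s := con 2 :+ (con 2 :* d :+ s)) ≡.refl (d π) (s π))
  (cong (suc ∘ suc) (2d+s≡length cut))
  where open +-*-Solver

-- The statistic `rb` on layered matchings

layeredRb : Partition → ℕ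
layeredRb []      = 0
layeredRb (B ∷ π) = length B * length π + layeredRb π

<max-blocks : ∀ {c as π} → All (c <_) as → Cut as π → All (λ C → c < max 0 C) π
<max-blocks []                  []               = []
<max-blocks (c<a ∷ c<as)        (single a cut)   =
  v<max⁺ 0 (a ∷ []) (inj₂ (here c<a)) ∷ <max-blocks c<as cut
<max-blocks (c<a ∷ _ ∷ c<as)    (double a b cut) =
  v<max⁺ 0 (a ∷ b ∷ []) (inj₂ (here c<a)) ∷ <max-blocks c<as cut

rb≡layeredRb : ∀ {as π} → AllPairs _<_ as → Cut as π → rb π ≡ layeredRb π
rb≡layeredRb [] [] = ≡.refl
rb≡layeredRb (a< ∷ as↗) (single a cut)
  rewrite filter-all (λ C → a <? max 0 C) (<max-blocks a< cut) =
  -- With the filter equal to all of `π`, the sum over the block computes to `length B * length π`,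
  -- hence `≡.refl`.
  cong₂ _+_ ≡.refl (rb≡layeredRb as↗ cut)
rb≡layeredRb ((_ ∷ a<) ∷ b< ∷ as↗) (double a b cut)
  rewrite filter-all (λ C → a <? max 0 C) (<max-blocks a< cut)
        | filter-all (λ C → b <? max 0 C) (<max-blocks b< cut) =
  cong₂ _+_ ≡.refl (rb≡layeredRb as↗ cut)

applyUpTo-suc↗ : ∀ n → AllPairs _<_ (applyUpTo suc n)
applyUpTo-suc↗ n = AllPairs.applyUpTo⁺₁ suc n λ i<j _ → s≤s i<j

∈Π⇒Cut : ∀ n {π} → π ∈ Π n → Cut (applyUpTo suc n) π
∈Π⇒Cut n = ∈-cuts⁻ (applyUpTo suc n)

-- Exponents in the recurrence

[1+n]C2≡n+nC2 : ∀ n → suc n C 2 ≡ n + n C 2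
[1+n]C2≡n+nC2 n =
  ≡.trans (≡.sym (nCk+nC[k+1]≡[n+1]C[k+1] n 1)) (cong (_+ n C 2) (nC1≡n n))

firstExponent : ∀ m k → m + (suc k C 2 + m C 2) ≡ suc k C 2 + suc m C 2
firstExponent m k = ≡.trans
  (solve 3 (λ m a b → m :+ (a :+ b) := a :+ (m :+ b)) ≡.refl m (suc k C 2) (m C 2))
  (cong (suc k C 2 +_) (≡.sym ([1+n]C2≡n+nC2 m)))
  where open +-*-Solver

-- Balances the weight `2 * m` of a leading pair against the exponent `m ∸ k` of the q-Pascal rule.
-- The bound `k ≤ m` makes this a true subtraction.
secondExponent : ∀ {m k} → k ≤ m →
  2 * m + (k C 2 + m C 2) ≡ suc k C 2 + suc m C 2 + (m ∸ k)
secondExponent {m} {k} k≤m = begin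
  2 * m + (K + M)
    ≡⟨ solve 3 (λ m a b → con 2 :* m :+ (a :+ b) := a :+ (m :+ b) :+ m) ≡.refl m K M ⟩
  K + (m + M) + m
    ≡⟨ cong (K + (m + M) +_) (ℕ.m+[n∸m]≡n k≤m) ⟨
  K + (m + M) + (k + (m ∸ k))
    ≡⟨ solve 4 (λ a b k t → a :+ b :+ (k :+ t) := k :+ a :+ b :+ t) ≡.refl K (m + M) k (m ∸ k) ⟩
  k + K + (m + M) + (m ∸ k)
    ≡⟨ cong (_+ (m ∸ k)) (cong₂ _+_ ([1+n]C2≡n+nC2 k) ([1+n]C2≡n+nC2 m)) ⟨
  suc k C 2 + suc m C 2 + (m ∸ k) ∎
  where
  open ≡.≡-Reasoning
  open +-*-Solver
  K = k C 2
  M = m C 2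

-- Finite sums and products over a commutative ring

module FiniteSums {c ℓ : Level} (R : CommutativeRing c ℓ) where
  open CommutativeRing R hiding (zero) renaming (_+_ to _⊹_; _*_ to _∙_)
  open RingOps R
  open SetoidReasoning setoid
  private module S = SemiringSolver commutativeSemiring

  ∑-++ : ∀ {A : Set} (as bs : List A) f → ∑ (as ++ bs) f ≈ ∑ as f ⊹ ∑ bs f
  ∑-++ []       bs f = sym (+-identityˡ _)
  ∑-++ (a ∷ as) bs f = trans (+-congˡ (∑-++ as bs f)) (sym (+-assoc _ _ _))

  ∑-cong : ∀ {A : Set} (as : List A) {f g} → (∀ {a} → a ∈ as → f a ≈ g a) → ∑ as f ≈ ∑ as g
  ∑-cong []       f≈g = refl
  ∑-cong (a ∷ as) f≈g = +-cong (f≈g (here ≡.refl)) (∑-cong as (f≈g ∘ there))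

  ∑-distribˡ : ∀ {A : Set} c (as : List A) f → (∑[ a ∈ as ] c ∙ f a) ≈ c ∙ ∑ as f
  ∑-distribˡ c []       f = sym (zeroʳ c)
  ∑-distribˡ c (a ∷ as) f = trans (+-congˡ (∑-distribˡ c as f)) (sym (distribˡ c _ _))

  ∑-upTo-suc : ∀ n f → ∑ (upTo (suc n)) f ≈ ∑ (upTo n) f ⊹ f n
  ∑-upTo-suc n f = begin
    ∑ (upTo (suc n)) f            ≡⟨ cong (λ as → ∑ as f) (upTo-∷ʳ n) ⟨
    ∑ (upTo n ++ n ∷ []) f        ≈⟨ ∑-++ (upTo n) (n ∷ []) f ⟩
    ∑ (upTo n) f ⊹ (f n ⊹ 0#)     ≈⟨ +-congˡ (+-identityʳ (f n)) ⟩
    ∑ (upTo n) f ⊹ f n            ∎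

  -- Only the Booleans of the two decisions are compared, so when prepending a block shifts `d` by a
  -- constant the hypothesis holds by computation.
  ∑-filter-map : ∀ {A B : Set} {p} {P : Pred B p} {Q : Pred A p} (P? : Decidable P) (Q? : Decidable Q)
    (h : A → B) → (∀ a → does (P? (h a)) ≡ does (Q? a)) →
    ∀ as f → ∑ (filter P? (map h as)) f ≡ ∑ (filter Q? as) (f ∘ h)
  ∑-filter-map P? Q? h P≡Q []       f = ≡.refl
  ∑-filter-map P? Q? h P≡Q (a ∷ as) f with does (P? (h a)) | does (Q? a) | P≡Q a
  ... | true  | .true  | ≡.refl = cong (f (h a) ⊹_) (∑-filter-map P? Q? h P≡Q as f)
  ... | false | .false | ≡.refl = ∑-filter-map P? Q? h P≡Q as f

  ∑-zero : ∀ {A : Set} (as : List A) → ∑ as (λ _ → 0#) ≈ 0#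
  ∑-zero []       = refl
  ∑-zero (_ ∷ as) = trans (+-identityˡ _) (∑-zero as)

  -- The effect on a family of fibre sums of one new element of weight `v` lying in fibre `i`.
  addAt : ℕ → Carrier → (ℕ → Carrier) → ℕ → Carrier
  addAt i v h k = if does (i ≟ k) then v ⊹ h k else h k

  addAt-≡ : ∀ i v h → addAt i v h i ≡ v ⊹ h i
  addAt-≡ i v h = cong (if_then v ⊹ h i else h i) (dec-true (i ≟ i) ≡.refl)

  addAt-≢ : ∀ {i k} v h → i ≢ k → addAt i v h k ≡ h k
  addAt-≢ {i} {k} v h i≢k = cong (if_then v ⊹ h k else h k) (dec-false (i ≟ k) i≢k)

  ∑-addAt : ∀ n {i} → i < n → ∀ v h → ∑ (upTo n) (addAt i v h) ≈ v ⊹ ∑ (upTo n) h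
  ∑-addAt (suc n) {i} (s≤s i≤n) v h with i ≟ n
  ... | yes ≡.refl = begin
    ∑ (upTo (suc n)) (addAt n v h)
      ≈⟨ ∑-upTo-suc n _ ⟩
    ∑ (upTo n) (addAt n v h) ⊹ addAt n v h n
      ≈⟨ +-cong (∑-cong (upTo n) λ k∈ → reflexive (addAt-≢ v h (ℕ.<⇒≢ (∈-upTo⁻ k∈) ∘ ≡.sym)))
                (reflexive (addAt-≡ n v h)) ⟩
    ∑ (upTo n) h ⊹ (v ⊹ h n)
      ≈⟨ S.solve 3 (λ a v b → a S.:+ (v S.:+ b) S.:= v S.:+ (a S.:+ b)) refl _ _ _ ⟩
    v ⊹ (∑ (upTo n) h ⊹ h n)
      ≈⟨ +-congˡ (∑-upTo-suc n h) ⟨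
    v ⊹ ∑ (upTo (suc n)) h ∎
  ... | no i≢n = begin
    ∑ (upTo (suc n)) (addAt i v h)
      ≈⟨ ∑-upTo-suc n _ ⟩
    ∑ (upTo n) (addAt i v h) ⊹ addAt i v h n
      ≈⟨ +-cong (∑-addAt n (ℕ.≤∧≢⇒< i≤n i≢n) v h) (reflexive (addAt-≢ v h i≢n)) ⟩
    v ⊹ ∑ (upTo n) h ⊹ h n
      ≈⟨ +-assoc _ _ _ ⟩
    v ⊹ (∑ (upTo n) h ⊹ h n)
      ≈⟨ +-congˡ (∑-upTo-suc n h) ⟨
    v ⊹ ∑ (upTo (suc n)) h ∎

  -- Induction on the list: a new element enters exactly one fibre sum, and `δ a < n` places that
  -- fibre in the range of summation.
  ∑-fibres : ∀ {A : Set} (δ : A → ℕ) n (as : List A) f → (∀ {a} → a ∈ as → δ a < n) →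
    ∑ as f ≈ (∑[ k ∈ upTo n ] ∑ (filter (λ a → δ a ≟ k) as) f)
  ∑-fibres δ n []       f δ<n = sym (∑-zero (upTo n))
  ∑-fibres δ n (a ∷ as) f δ<n = begin
    f a ⊹ ∑ as f
      ≈⟨ +-congˡ (∑-fibres δ n as f (δ<n ∘ there)) ⟩
    f a ⊹ ∑ (upTo n) fibreSum
      ≈⟨ ∑-addAt n (δ<n (here ≡.refl)) (f a) fibreSum ⟨
    ∑ (upTo n) (addAt (δ a) (f a) fibreSum)
      ≈⟨ ∑-cong (upTo n) (λ {k} _ → reflexive (fibreSum-∷ k)) ⟩
    (∑[ k ∈ upTo n ] ∑ (filter (λ a → δ a ≟ k) (a ∷ as)) f) ∎
    where
    fibreSum : ℕ → Carrier
    fibreSum k = ∑ (filter (λ a → δ a ≟ k) as) f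

    fibreSum-∷ : ∀ k → addAt (δ a) (f a) fibreSum k ≡ ∑ (filter (λ a → δ a ≟ k) (a ∷ as)) f
    fibreSum-∷ k with does (δ a ≟ k)
    ... | true  = ≡.refl
    ... | false = ≡.refl

  ∏-++ : ∀ {A : Set} (as bs : List A) f → ∏ (as ++ bs) f ≈ ∏ as f ∙ ∏ bs f
  ∏-++ []       bs f = sym (*-identityˡ _)
  ∏-++ (a ∷ as) bs f = trans (*-congˡ (∏-++ as bs f)) (sym (*-assoc _ _ _))

  ∏-upTo-suc : ∀ n f → ∏ (upTo (suc n)) f ≈ ∏ (upTo n) f ∙ f n
  ∏-upTo-suc n f = begin
    ∏ (upTo (suc n)) f            ≡⟨ cong (λ as → ∏ as f) (upTo-∷ʳ n) ⟨
    ∏ (upTo n ++ n ∷ []) f        ≈⟨ ∏-++ (upTo n) (n ∷ []) f ⟩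
    ∏ (upTo n) f ∙ (f n ∙ 1#)     ≈⟨ *-congˡ (*-identityʳ (f n)) ⟩
    ∏ (upTo n) f ∙ f n            ∎

  ∏-upTo-suc′ : ∀ n f → ∏ (upTo (suc n)) f ≡ f 0 ∙ ∏ (upTo n) (f ∘ suc)
  ∏-upTo-suc′ n f = cong (λ l → f 0 ∙ foldr _∙_ 1# l)
    (≡.trans (map-applyUpTo suc f n) (≡.sym (map-upTo (f ∘ suc) n)))

  ∏-cong : ∀ {A : Set} (as : List A) {f g} → (∀ {a} → a ∈ as → f a ≈ g a) → ∏ as f ≈ ∏ as g
  ∏-cong []       f≈g = refl
  ∏-cong (a ∷ as) f≈g = *-cong (f≈g (here ≡.refl)) (∏-cong as (f≈g ∘ there))

-- Gaussian polynomials and the product formula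

module GaussianPolynomials {c ℓ : Level} (R : CommutativeRing c ℓ) (q : CommutativeRing.Carrier R) where
  open CommutativeRing R hiding (zero) renaming (_+_ to _⊹_; _*_ to _∙_; _-_ to _⊖_; -_ to ⊖_)
  open RingOps R
  open import Algebra.Properties.Semiring.Exp semiring using (^-homo-*; ^-congʳ)
  open FiniteSums R
  open SetoidReasoning setoid
  private module S = SemiringSolver commutativeSemiring

  gauss : ℕ → ℕ → Carrier
  gauss m       zero    = 1#
  gauss zero    (suc k) = 0#
  gauss (suc m) (suc k) = gauss m (suc k) ⊹ q ^ (m ∸ k) ∙ gauss m k

  -- Beyond the diagonal both terms of the recurrence vanish by induction, so a truncated `m ∸ k`
  -- only ever multiplies zero.
  gauss-vanishes : ∀ {m k} → m < k → gauss m k ≈ 0#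
  gauss-vanishes {zero}  {suc k} _         = refl
  gauss-vanishes {suc m} {suc k} (s≤s m<k) = begin
    gauss m (suc k) ⊹ q ^ (m ∸ k) ∙ gauss m k
      ≈⟨ +-cong (gauss-vanishes (ℕ.m<n⇒m<1+n m<k)) (*-congˡ (gauss-vanishes m<k)) ⟩
    0# ⊹ q ^ (m ∸ k) ∙ 0#  ≈⟨ +-identityˡ _ ⟩
    q ^ (m ∸ k) ∙ 0#       ≈⟨ zeroʳ _ ⟩
    0#                     ∎

  -- For m < k the factor at j = m is q⁰ - 1 = 0, whereas m ∸ suc j + 1 in qBinomial would give q - 1.
  falling : ℕ → ℕ → Carrier
  falling m k = ∏[ j ∈ upTo k ] (q ^ (m ∸ j) ⊖ 1#)

  -- This is `(q - 1)^k` times the q-factorial of `k`; it serves as the denominator of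
  -- `qBinomial m k` for `k ≤ m`.
  factorial : ℕ → Carrier
  factorial k = ∏[ j ∈ upTo k ] (q ^ suc j ⊖ 1#)

  falling-vanishes : ∀ {m k} → m < k → falling m k ≈ 0#
  falling-vanishes {zero}  {suc k} _         = begin
    falling 0 (suc k)                               ≡⟨ ∏-upTo-suc′ k _ ⟩
    (1# ⊖ 1#) ∙ (∏[ j ∈ upTo k ] (q ^ 0 ⊖ 1#))     ≈⟨ *-congʳ (-‿inverseʳ 1#) ⟩
    0# ∙ (∏[ j ∈ upTo k ] (q ^ 0 ⊖ 1#))            ≈⟨ zeroˡ _ ⟩
    0#                                              ∎
  falling-vanishes {suc m} {suc k} (s≤s m<k) = begin
    -- Without its first factor the product is `falling m k`, since `suc m ∸ suc j` computes to
    -- `m ∸ j`.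
    falling (suc m) (suc k)           ≡⟨ ∏-upTo-suc′ k _ ⟩
    (q ^ suc m ⊖ 1#) ∙ falling m k    ≈⟨ *-congˡ (falling-vanishes m<k) ⟩
    (q ^ suc m ⊖ 1#) ∙ 0#             ≈⟨ zeroʳ _ ⟩
    0#                                ∎

  -- For `k ≤ m`, put `u = q^(m-k)` and `v = q^(k+1)`: then `(u - 1) + u (v - 1) = u v - 1` with
  -- `u v = q^(m+1)`, all multiplied by `falling m k`. For `k > m` every term is zero.
  falling-pascal : ∀ m k →
    falling m (suc k) ⊹ q ^ (m ∸ k) ∙ (falling m k ∙ (q ^ suc k ⊖ 1#)) ≈ falling (suc m) (suc k)
  falling-pascal m k with k ≤? m
  ... | yes k≤m = begin
    falling m (suc k) ⊹ u ∙ (N ∙ (v ⊖ 1#))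
      ≈⟨ +-congʳ (∏-upTo-suc k _) ⟩
    N ∙ (u ⊖ 1#) ⊹ u ∙ (N ∙ (v ⊖ 1#))
      -- The atom `i` stands for `- 1`; the leftover `u (1 + i)` is cancelled in the next step.
      ≈⟨ S.solve 4 (λ N u v i → N S.:* (u S.:+ i) S.:+ u S.:* (N S.:* (v S.:+ i))
                          S.:= N S.:* (u S.:* v S.:+ i) S.:+ N S.:* (u S.:* (S.con 1 S.:+ i)))
                   refl N u v (⊖ 1#) ⟩
    N ∙ (u ∙ v ⊖ 1#) ⊹ N ∙ (u ∙ (1# ⊖ 1#))
      ≈⟨ +-congˡ (trans (*-congˡ (trans (*-congˡ (-‿inverseʳ 1#)) (zeroʳ u))) (zeroʳ N)) ⟩
    N ∙ (u ∙ v ⊖ 1#) ⊹ 0#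
      ≈⟨ trans (+-identityʳ _) (*-comm N _) ⟩
    (u ∙ v ⊖ 1#) ∙ N
      ≈⟨ *-congʳ (+-congʳ (trans (sym (^-homo-* q (m ∸ k) (suc k)))
           (^-congʳ q (≡.trans (ℕ.+-suc (m ∸ k) k) (cong suc (ℕ.m∸n+n≡m k≤m)))))) ⟩
    (q ^ suc m ⊖ 1#) ∙ N
      ≡⟨ ∏-upTo-suc′ k _ ⟨
    falling (suc m) (suc k) ∎
    where
    N = falling m k
    u = q ^ (m ∸ k)
    v = q ^ suc k
  ... | no k≰m = begin
    falling m (suc k) ⊹ u ∙ (falling m k ∙ w)
      ≈⟨ +-cong (falling-vanishes (ℕ.m<n⇒m<1+n m<k)) (*-congˡ (*-congʳ (falling-vanishes m<k))) ⟩
    0# ⊹ u ∙ (0# ∙ w)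
      ≈⟨ S.solve 2 (λ u w → S.con 0 S.:+ u S.:* (S.con 0 S.:* w) S.:= S.con 0) refl u w ⟩
    0#
      ≈⟨ falling-vanishes (s≤s m<k) ⟨
    falling (suc m) (suc k) ∎
    where
    m<k = ℕ.≰⇒> k≰m
    u = q ^ (m ∸ k)
    w = q ^ suc k ⊖ 1#

  -- The product formula without division: multiplying the q-Pascal rule by `factorial (suc k)`
  -- turns it into `falling-pascal`.
  gauss∙factorial≈falling : ∀ m k → gauss m k ∙ factorial k ≈ falling m k
  gauss∙factorial≈falling m       zero    = *-identityˡ 1#
  gauss∙factorial≈falling zero    (suc k) =
    trans (zeroˡ _) (sym (falling-vanishes {0} {suc k} (s≤s z≤n)))
  gauss∙factorial≈falling (suc m) (suc k) = begin
    (gauss m (suc k) ⊹ u ∙ gauss m k) ∙ factorial (suc k)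
      ≈⟨ distribʳ _ _ _ ⟩
    gauss m (suc k) ∙ factorial (suc k) ⊹ u ∙ gauss m k ∙ factorial (suc k)
      ≈⟨ +-cong (gauss∙factorial≈falling m (suc k)) (*-congˡ (∏-upTo-suc k _)) ⟩
    falling m (suc k) ⊹ u ∙ gauss m k ∙ (factorial k ∙ w)
      ≈⟨ +-congˡ (S.solve 4 (λ u g f w → u S.:* g S.:* (f S.:* w) S.:= u S.:* (g S.:* f S.:* w))
                           refl u _ _ w) ⟩
    falling m (suc k) ⊹ u ∙ (gauss m k ∙ factorial k ∙ w)
      ≈⟨ +-congˡ (*-congˡ (*-congʳ (gauss∙factorial≈falling m k))) ⟩
    falling m (suc k) ⊹ u ∙ (falling m k ∙ w)
      ≈⟨ falling-pascal m k ⟩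
    falling (suc m) (suc k) ∎
    where
    u = q ^ (m ∸ k)
    w = q ^ suc k ⊖ 1#

  -- The closed form and its recurrence

  closedForm : ℕ → ℕ → Carrier
  closedForm m k = q ^ (k C 2 + m C 2) ∙ gauss m k

  closedForm-zero : ∀ m → q ^ m ∙ closedForm m 0 ≈ closedForm (suc m) 0
  closedForm-zero m = begin
    q ^ m ∙ (q ^ (m C 2) ∙ 1#)   ≈⟨ *-assoc _ _ _ ⟨
    q ^ m ∙ q ^ (m C 2) ∙ 1#     ≈⟨ *-congʳ (^-homo-* q m (m C 2)) ⟨
    q ^ (m + m C 2) ∙ 1#         ≡⟨ cong (λ e → q ^ e ∙ 1#) ([1+n]C2≡n+nC2 m) ⟨
    q ^ (suc m C 2) ∙ 1#         ∎

  closedForm-pascal : ∀ m k →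
    q ^ m ∙ closedForm m (suc k) ⊹ q ^ (2 * m) ∙ closedForm m k ≈ closedForm (suc m) (suc k)
  closedForm-pascal m k = begin
    q ^ m ∙ (q ^ (suc k C 2 + m C 2) ∙ gauss m (suc k)) ⊹ q ^ (2 * m) ∙ (q ^ (k C 2 + m C 2) ∙ gauss m k)
      ≈⟨ +-cong (merge m (suc k C 2 + m C 2) (firstExponent m k)) second ⟩
    q ^ e ∙ gauss m (suc k) ⊹ q ^ e ∙ (q ^ (m ∸ k) ∙ gauss m k)
      ≈⟨ distribˡ _ _ _ ⟨
    q ^ e ∙ gauss (suc m) (suc k) ∎
    where
    e = suc k C 2 + suc m C 2

    merge : ∀ i j {l g} → i + j ≡ l → q ^ i ∙ (q ^ j ∙ g) ≈ q ^ l ∙ g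
    merge i j i+j≡l = trans (sym (*-assoc _ _ _))
      (*-congʳ (trans (sym (^-homo-* q i j)) (^-congʳ q i+j≡l)))

    second : q ^ (2 * m) ∙ (q ^ (k C 2 + m C 2) ∙ gauss m k) ≈ q ^ e ∙ (q ^ (m ∸ k) ∙ gauss m k)
    second with k ≤? m
    ... | yes k≤m = trans (merge (2 * m) (k C 2 + m C 2) (secondExponent k≤m)) (sym (merge e (m ∸ k) ≡.refl))
    -- The two exponents need not agree here, but both sides contain `gauss m k`, which is zero.
    ... | no k≰m  = trans (vanish _ _) (sym (vanish _ _))
      where
      vanish : ∀ a b → a ∙ (b ∙ gauss m k) ≈ 0#
      vanish a b = trans (*-congˡ (trans (*-congˡ (gauss-vanishes (ℕ.≰⇒> k≰m))) (zeroʳ b))) (zeroʳ a)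

  closedForm-vanishes : ∀ {m k} → m < k → closedForm m k ≈ 0#
  closedForm-vanishes m<k = trans (*-congˡ (gauss-vanishes m<k)) (zeroʳ _)

  -- Layered matchings with a fixed number of two-element blocks

  -- Stated for arbitrary lists because the recursion of `cuts` passes to tails, which no longer
  -- start at 1; `layeredRb` sees only block sizes.
  layeredSum : ℕ → List ℕ → Carrier
  layeredSum k as = ∑[ π ∈ filter (λ π → d π ≟ k) (cuts as) ] q ^ layeredRb π

  -- Splits by the first block. A leading singleton leaves `d` unchanged, so that half is already
  -- reindexed; the other half depends on whether `k` is zero.
  layeredSum-split : ∀ k a b as → layeredSum k (a ∷ b ∷ as) ≈
    (∑[ π ∈ filter (λ π → d π ≟ k) (cuts (b ∷ as)) ] q ^ layeredRb ((a ∷ []) ∷ π)) ⊹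
    (∑[ π ∈ filter (λ π → d π ≟ k) (map ((a ∷ b ∷ []) ∷_) (cuts as)) ] q ^ layeredRb π)
  layeredSum-split k a b as = begin
    layeredSum k (a ∷ b ∷ as)
      ≡⟨ cong (λ πs → ∑ πs (λ π → q ^ layeredRb π))
           (filter-++ k? (map ((a ∷ []) ∷_) (cuts (b ∷ as))) _) ⟩
    ∑ (filter k? (map ((a ∷ []) ∷_) (cuts (b ∷ as))) ++ filter k? (map ((a ∷ b ∷ []) ∷_) (cuts as)))
      (λ π → q ^ layeredRb π)
      ≈⟨ ∑-++ (filter k? (map ((a ∷ []) ∷_) (cuts (b ∷ as)))) _ _ ⟩
    ∑ (filter k? (map ((a ∷ []) ∷_) (cuts (b ∷ as)))) (λ π → q ^ layeredRb π) ⊹ _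
      ≈⟨ +-congʳ (reflexive (∑-filter-map k? k? ((a ∷ []) ∷_) (λ _ → ≡.refl) (cuts (b ∷ as)) _)) ⟩
    _ ∎
    where
    k? : Decidable (λ π → d π ≡ k)
    k? π = d π ≟ k

  private
    blocks : ∀ k as {π} → π ∈ filter (λ π → d π ≟ k) (cuts as) → length π ≡ length as ∸ k
    blocks k as {π} π∈ with π∈cuts , ≡.refl ← ∈-filter⁻ (λ π → d π ≟ k) π∈ =
      ≡.trans (≡.sym (ℕ.m+n∸n≡m (length π) (d π)))
              (cong (_∸ d π) (length+d≡length (∈-cuts⁻ as π∈cuts)))

  -- By `blocks`, all matchings in the sum have the same number of blocks, so prepending `B`
  -- multiplies every term by the same power of `q`.
  layeredSum-∷ : ∀ k as (B : List ℕ) →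
    (∑[ π ∈ filter (λ π → d π ≟ k) (cuts as) ] q ^ layeredRb (B ∷ π))
      ≈ q ^ (length B * (length as ∸ k)) ∙ layeredSum k as
  layeredSum-∷ k as B = trans
    (∑-cong (filter (λ π → d π ≟ k) (cuts as)) λ {π} π∈ →
      trans (^-homo-* q (length B * length π) (layeredRb π))
            (*-congʳ (^-congʳ q (cong (length B *_) (blocks k as π∈)))))
    (∑-distribˡ _ (filter (λ π → d π ≟ k) (cuts as)) _)

  layeredSum≈closedForm : ∀ k as → layeredSum k as ≈ closedForm (length as ∸ k) k
  layeredSum≈closedForm zero    []       = trans (+-identityʳ 1#) (sym (*-identityˡ 1#))
  layeredSum≈closedForm (suc k) []       = sym (closedForm-vanishes {0} {suc k} (s≤s z≤n))
  layeredSum≈closedForm zero    (a ∷ []) = trans (+-identityʳ 1#) (sym (*-identityˡ 1#))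
  layeredSum≈closedForm (suc k) (a ∷ []) rewrite ℕ.0∸n≡0 k =
    sym (closedForm-vanishes {0} {suc k} (s≤s z≤n))
  layeredSum≈closedForm zero (a ∷ b ∷ as) = begin
    layeredSum 0 (a ∷ b ∷ as)
      ≈⟨ layeredSum-split 0 a b as ⟩
    _ ⊹ ∑ (filter (λ π → d π ≟ 0) (map ((a ∷ b ∷ []) ∷_) (cuts as))) (λ π → q ^ layeredRb π)
      ≈⟨ +-congˡ (reflexive (cong (λ πs → ∑ πs (λ π → q ^ layeredRb π))
           -- A matching starting with a pair has `d` a successor, so none survives the filter.
           (filter-none (λ π → d π ≟ 0) (All.map⁺ {xs = cuts as} (All.tabulate λ _ ()))))) ⟩
    _ ⊹ 0#
      ≈⟨ +-identityʳ _ ⟩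
    ∑[ π ∈ filter (λ π → d π ≟ 0) (cuts (b ∷ as)) ] q ^ layeredRb ((a ∷ []) ∷ π)
      ≈⟨ layeredSum-∷ 0 (b ∷ as) (a ∷ []) ⟩
    q ^ (1 * suc n) ∙ layeredSum 0 (b ∷ as)
      ≈⟨ *-cong (^-congʳ q (ℕ.*-identityˡ (suc n))) (layeredSum≈closedForm 0 (b ∷ as)) ⟩
    q ^ suc n ∙ closedForm (suc n) 0
      ≈⟨ closedForm-zero (suc n) ⟩
    closedForm (suc (suc n)) 0 ∎
    where n = length as
  layeredSum≈closedForm (suc k) (a ∷ b ∷ as) = begin
    layeredSum (suc k) (a ∷ b ∷ as)
      ≈⟨ layeredSum-split (suc k) a b as ⟩
    _ ⊹ ∑ (filter (λ π → d π ≟ suc k) (map ((a ∷ b ∷ []) ∷_) (cuts as))) (λ π → q ^ layeredRb π)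
      ≈⟨ +-congˡ (reflexive (∑-filter-map (λ π → d π ≟ suc k) (λ π → d π ≟ k) ((a ∷ b ∷ []) ∷_)
           (λ _ → ≡.refl) (cuts as) _)) ⟩
    _ ⊹ _
      ≈⟨ +-cong (layeredSum-∷ (suc k) (b ∷ as) (a ∷ [])) (layeredSum-∷ k as (a ∷ b ∷ [])) ⟩
    q ^ (1 * m) ∙ layeredSum (suc k) (b ∷ as) ⊹ q ^ (2 * m) ∙ layeredSum k as
      ≈⟨ +-cong (*-cong (^-congʳ q (ℕ.*-identityˡ m)) (layeredSum≈closedForm (suc k) (b ∷ as)))
                (*-congˡ (layeredSum≈closedForm k as)) ⟩
    q ^ m ∙ closedForm m (suc k) ⊹ q ^ (2 * m) ∙ closedForm m k
      ≈⟨ recurrence ⟩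
    closedForm (suc (length as) ∸ k) (suc k) ∎
    where
    -- The number of blocks after the first one, for either size of that block:
    -- `suc (length as) ∸ suc k` computes to the same value.
    m = length as ∸ k

    recurrence : q ^ m ∙ closedForm m (suc k) ⊹ q ^ (2 * m) ∙ closedForm m k
                   ≈ closedForm (suc (length as) ∸ k) (suc k)
    recurrence with k ≤? length as
    ... | yes k≤n = trans (closedForm-pascal m k)
      (reflexive (cong (λ m → closedForm m (suc k)) (≡.sym (ℕ.+-∸-assoc 1 k≤n))))
    -- Here `suc (length as) ∸ k` is not `suc m`, so the recurrence does not apply directly; instead
    -- both sides vanish.
    ... | no k≰n = begin
      q ^ m ∙ closedForm m (suc k) ⊹ q ^ (2 * m) ∙ closedForm m k
        ≈⟨ +-cong (*-congˡ (closedForm-vanishes (ℕ.m<n⇒m<1+n m<k))) (*-congˡ (closedForm-vanishes m<k)) ⟩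
      q ^ m ∙ 0# ⊹ q ^ (2 * m) ∙ 0#
        ≈⟨ S.solve 2 (λ u v → u S.:* S.con 0 S.:+ v S.:* S.con 0 S.:= S.con 0) refl (q ^ m) (q ^ (2 * m)) ⟩
      0#
        ≈⟨ closedForm-vanishes 1+n∸k<1+k ⟨
      closedForm (suc (length as) ∸ k) (suc k) ∎
      where
      n<k = ℕ.≰⇒> k≰n
      m<k : m < k
      m<k = ℕ.≤-<-trans (ℕ.m∸n≤m (length as) k) n<k
      1+n∸k<1+k : suc (length as) ∸ k < suc k
      1+n∸k<1+k = s≤s (ℕ.≤-trans (ℕ.m∸n≤m _ k) n<k)

-- Passage to fractions

module FractionProperties {c ℓ : Level} (R : CommutativeRing c ℓ) where
  open CommutativeRing R renaming (_+_ to _⊹_; _*_ to _∙_)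
  private
    module Frac = Fractions R
    module Q = CommutativeRing Frac.fractionRing
    module R = RingOps R
    module QO = RingOps Frac.fractionRing
    module S = SemiringSolver commutativeSemiring

  ι-cong : ∀ {a b} → a ≈ b → Frac.ι a Q.≈ Frac.ι b
  ι-cong a≈b = Frac.cross (*-congʳ a≈b)

  ι-* : ∀ a b → Frac.ι (a ∙ b) Q.≈ Frac.ι a Q.* Frac.ι b
  ι-* a b = Frac.cross (S.solve 2 (λ a b → a S.:* b S.:* (S.con 1 S.:* S.con 1)
    S.:= a S.:* b S.:* S.con 1) refl a b)

  ι-+ : ∀ a b → Frac.ι (a ⊹ b) Q.≈ Frac.ι a Q.+ Frac.ι b
  ι-+ a b = Frac.cross (S.solve 2 (λ a b → (a S.:+ b) S.:* (S.con 1 S.:* S.con 1)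
    S.:= (a S.:* S.con 1 S.:+ b S.:* S.con 1) S.:* S.con 1) refl a b)

  ι-∑ : ∀ {A : Set} (as : List A) f → Frac.ι (R.∑ as f) Q.≈ QO.∑ as (Frac.ι ∘ f)
  ι-∑ []       f = Q.refl
  ι-∑ (a ∷ as) f = Q.trans (ι-+ (f a) (R.∑ as f)) (Q.+-congˡ {Frac.ι (f a)} (ι-∑ as f))

  -- Fractions are multiplied without cancellation, so numerators and denominators of a product can
  -- be read off as products.
  num-∏ : ∀ {A : Set} (as : List A) f → Frac.Fraction.num (QO.∏ as f) ≡ R.∏ as (Frac.Fraction.num ∘ f)
  num-∏ []       f = ≡.refl
  num-∏ (a ∷ as) f = cong (Frac.Fraction.num (f a) ∙_) (num-∏ as f)

  den-∏ : ∀ {A : Set} (as : List A) f → Frac.Fraction.den (QO.∏ as f) ≡ R.∏ as (Frac.Fraction.den ∘ f)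
  den-∏ []       f = ≡.refl
  den-∏ (a ∷ as) f = cong (Frac.Fraction.den (f a) ∙_) (den-∏ as f)

-- Gaussian polynomials as q-binomial coefficients

open FiniteSums ℤ[x,y,q] using (∑-cong; ∑-distribˡ; ∑-fibres; ∏-cong)
open GaussianPolynomials ℤ[x,y,q] q
open FractionProperties ℤ[x,y,q]

factor : ℕ → ℕ → Fraction
factor m j = (q P.^ (m ∸ suc j + 1) P.- P.1#) / (q P.^ suc j P.- P.1#) by q^i-1-regular (suc j)

qBinomial≈gauss : ∀ m k → qBinomial m k K.≈ ι (gauss m k)
qBinomial≈gauss m k with k ≤? m
... | no k≰m = K.trans
  (K.reflexive (cong (if_then K.∏ (upTo k) (factor m) else K.0#) (dec-false (k ≤? m) k≰m)))
  (ι-cong (P.sym (gauss-vanishes (ℕ.≰⇒> k≰m))))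
... | yes k≤m = K.trans
  (K.reflexive (cong (if_then K.∏ (upTo k) (factor m) else K.0#) (dec-true (k ≤? m) k≤m)))
  (cross (begin
  Fraction.num (K.∏ (upTo k) (factor m)) P.* P.1#
    ≈⟨ P.*-identityʳ _ ⟩
  Fraction.num (K.∏ (upTo k) (factor m))
    ≡⟨ num-∏ (upTo k) (factor m) ⟩
  P.∏[ j ∈ upTo k ] (q P.^ (m ∸ suc j + 1) P.- P.1#)
    -- Since `j < k ≤ m`, the exponent `m ∸ suc j + 1` is `m ∸ j`; truncation would break this for
    -- `j ≥ m`.
    ≈⟨ ∏-cong (upTo k) (λ {j} j∈ → P.reflexive (cong (λ i → q P.^ i P.- P.1#)
         (≡.trans (ℕ.+-comm (m ∸ suc j) 1)
                  (≡.sym (ℕ.+-∸-assoc 1 (ℕ.≤-trans (∈-upTo⁻ j∈) k≤m)))))) ⟩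
  falling m k
    ≈⟨ gauss∙factorial≈falling m k ⟨
  gauss m k P.* factorial k
    ≡⟨ cong (gauss m k P.*_) (den-∏ (upTo k) (factor m)) ⟨
  gauss m k P.* Fraction.den (K.∏ (upTo k) (factor m)) ∎))
  where
  open SetoidReasoning P.setoid

-- Generating functions of layered matchings

∑q^rb≈closedForm : ∀ n k → (P.∑[ π ∈ filter (λ π → d π ≟ k) (Π n) ] q P.^ rb π) P.≈ closedForm (n ∸ k) k
∑q^rb≈closedForm n k = begin
  P.∑[ π ∈ filter (λ π → d π ≟ k) (Π n) ] q P.^ rb π
    ≈⟨ ∑-cong (filter (λ π → d π ≟ k) (Π n)) (λ π∈ → P.reflexive (cong (q P.^_)
         (rb≡layeredRb (applyUpTo-suc↗ n) (∈Π⇒Cut n (∈-filter⁻-cuts π∈))))) ⟩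
  layeredSum k (applyUpTo suc n)
    ≈⟨ layeredSum≈closedForm k (applyUpTo suc n) ⟩
  closedForm (length (applyUpTo suc n) ∸ k) k
    ≡⟨ cong (λ n → closedForm (n ∸ k) k) (length-applyUpTo suc n) ⟩
  closedForm (n ∸ k) k ∎
  where
  open SetoidReasoning P.setoid
  ∈-filter⁻-cuts : ∀ {π} → π ∈ filter (λ π → d π ≟ k) (Π n) → π ∈ Π n
  ∈-filter⁻-cuts π∈ with π∈Π , _ ← ∈-filter⁻ (λ π → d π ≟ k) π∈ = π∈Π

2d+s≡n : ∀ n {π} → π ∈ Π n → 2 * d π + s π ≡ n
2d+s≡n n π∈ = ≡.trans (2d+s≡length (∈Π⇒Cut n π∈)) (length-applyUpTo suc n)

d≤n : ∀ n {π} → π ∈ Π n → d π ≤ n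
d≤n n {π} π∈ = ℕ.≤-trans (ℕ.m≤m+n (d π) _)
  (ℕ.≤-trans (ℕ.m≤m+n (2 * d π) (s π)) (ℕ.≤-reflexive (2d+s≡n n π∈)))

-- Groups the matchings by `d`. As `d π ≤ n`, any cutoff `N ≥ n` captures every fibre, which
-- expresses the sum over all `k ≥ 0`.
F-by-doubletons : ∀ n N → n ≤ N → F n P.≈
  (P.∑[ k ∈ upTo (suc N) ] x P.^ (n ∸ 2 * k) P.* y P.^ k P.* closedForm (n ∸ k) k)
F-by-doubletons n N n≤N = begin
  F n
    ≈⟨ ∑-fibres d (suc N) (Π n) _ (λ π∈ → s≤s (ℕ.≤-trans (d≤n n π∈) n≤N)) ⟩
  P.∑[ k ∈ upTo (suc N) ] P.∑[ π ∈ filter (λ π → d π ≟ k) (Π n) ]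
    x P.^ s π P.* y P.^ d π P.* q P.^ rb π
    ≈⟨ ∑-cong (upTo (suc N)) (λ {k} _ → fibre k) ⟩
  (P.∑[ k ∈ upTo (suc N) ] x P.^ (n ∸ 2 * k) P.* y P.^ k P.* closedForm (n ∸ k) k) ∎
  where
  open SetoidReasoning P.setoid

  weight : ∀ k {π} → π ∈ filter (λ π → d π ≟ k) (Π n) →
    x P.^ s π P.* y P.^ d π P.* q P.^ rb π ≡ x P.^ (n ∸ 2 * k) P.* y P.^ k P.* q P.^ rb π
  -- Matching on `≡.refl` replaces `k` by `d π`; then `2 * d π + s π ≡ n` determines the exponent of
  -- `x`.
  weight k {π} π∈ with π∈Π , ≡.refl ← ∈-filter⁻ (λ π → d π ≟ k) π∈ =
    cong (λ i → x P.^ i P.* y P.^ d π P.* q P.^ rb π)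
      (≡.trans (≡.sym (ℕ.m+n∸m≡n (2 * d π) (s π))) (cong (_∸ 2 * d π) (2d+s≡n n π∈Π)))

  -- When `2 * k > n` the fibre is empty and `n ∸ 2 * k` truncates to 0, consistently with
  -- `gauss (n ∸ k) k` being zero.
  fibre : ∀ k → (P.∑[ π ∈ filter (λ π → d π ≟ k) (Π n) ] x P.^ s π P.* y P.^ d π P.* q P.^ rb π)
    P.≈ x P.^ (n ∸ 2 * k) P.* y P.^ k P.* closedForm (n ∸ k) k
  fibre k = begin
    P.∑[ π ∈ πs ] x P.^ s π P.* y P.^ d π P.* q P.^ rb π
      ≈⟨ ∑-cong πs (λ π∈ → P.reflexive (weight k π∈)) ⟩
    P.∑[ π ∈ πs ] x P.^ (n ∸ 2 * k) P.* y P.^ k P.* q P.^ rb π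
      ≈⟨ ∑-distribˡ (x P.^ (n ∸ 2 * k) P.* y P.^ k) πs _ ⟩
    x P.^ (n ∸ 2 * k) P.* y P.^ k P.* (P.∑[ π ∈ πs ] q P.^ rb π)
      ≈⟨ P.*-congˡ {x P.^ (n ∸ 2 * k) P.* y P.^ k} (∑q^rb≈closedForm n k) ⟩
    x P.^ (n ∸ 2 * k) P.* y P.^ k P.* closedForm (n ∸ k) k ∎
    where πs = filter (λ π → d π ≟ k) (Π n)

ι[*gauss] : ∀ a m k → ι (a P.* gauss m k) K.≈ ι a K.* qBinomial m k
ι[*gauss] a m k = K.trans (ι-* a (gauss m k)) (K.*-congˡ {ι a} (K.sym (qBinomial≈gauss m k)))

theorem4p6 : (n : ℕ) →
    ((N : ℕ) → n ≤ N →
    ι (F n) K.≈ (K.∑[ k ∈ upTo (suc N) ]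
    ι (x P.^ (n ∸ 2 * k) P.* y P.^ k P.* q P.^ (k C 2 + (n ∸ k) C 2)) K.* qBinomial (n ∸ k) k))
    × ((k : ℕ) →
    ι (P.∑[ π ∈ filter (λ π → d π ≟ k) (Π n) ] q P.^ rb π)
    K.≈ ι (q P.^ (k C 2 + (n ∸ k) C 2)) K.* qBinomial (n ∸ k) k)
theorem4p6 n = expansion , refinement
  where
  open SetoidReasoning K.setoid

  mono power : ℕ → P.Carrier
  mono k  = x P.^ (n ∸ 2 * k) P.* y P.^ k
  power k = q P.^ (k C 2 + (n ∸ k) C 2)

  expansion : ∀ N → n ≤ N → ι (F n) K.≈ (K.∑[ k ∈ upTo (suc N) ]
    ι (x P.^ (n ∸ 2 * k) P.* y P.^ k P.* q P.^ (k C 2 + (n ∸ k) C 2)) K.* qBinomial (n ∸ k) k)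
  expansion N n≤N = begin
    ι (F n)
      ≈⟨ ι-cong (F-by-doubletons n N n≤N) ⟩
    ι (P.∑[ k ∈ upTo (suc N) ] x P.^ (n ∸ 2 * k) P.* y P.^ k P.* closedForm (n ∸ k) k)
      ≈⟨ ι-∑ (upTo (suc N)) _ ⟩
    (K.∑[ k ∈ upTo (suc N) ] ι (x P.^ (n ∸ 2 * k) P.* y P.^ k P.* closedForm (n ∸ k) k))
      -- Unfolding `closedForm` and reassociating isolates the factor `gauss (n ∸ k) k`, which
      -- becomes the q-binomial.
      ≈⟨ KSums.∑-cong (upTo (suc N)) (λ {k} _ → K.trans
           (ι-cong (P.sym (P.*-assoc (mono k) (power k) (gauss (n ∸ k) k))))
           (ι[*gauss] (mono k P.* power k) (n ∸ k) k)) ⟩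
    (K.∑[ k ∈ upTo (suc N) ]
      ι (x P.^ (n ∸ 2 * k) P.* y P.^ k P.* q P.^ (k C 2 + (n ∸ k) C 2)) K.* qBinomial (n ∸ k) k) ∎
    where module KSums = FiniteSums fractionRing

  refinement : ∀ k → ι (P.∑[ π ∈ filter (λ π → d π ≟ k) (Π n) ] q P.^ rb π)
    K.≈ ι (q P.^ (k C 2 + (n ∸ k) C 2)) K.* qBinomial (n ∸ k) k
  refinement k = K.trans (ι-cong (∑q^rb≈closedForm n k)) (ι[*gauss] (power k) (n ∸ k) k)
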